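{- Let $p$ be an odd prime with $p\neq 17$. (i) If $p\equiv 1\pmod 4$, then $$\sum_{k=0}^{[p/4]}(-1)^k\binom{4k}{2k}\equiv\begin{cases}0\pmod p&\text{if }p\equiv \pm3,\pm5,\pm6,\pm7\pmod{17},\\ 17^{(p-1)/4}\pmod p&\text{if }p\equiv\pm1,\pm4\pmod{17},\\ -17^{(p-1)/4}\pmod p&\text{if }p\equiv\pm2,\pm8\pmod{17}.\end{cases}$$ (ii) If $p\equiv 3\pmod 4$, then $$\sum_{k=0}^{[p/4]}(-1)^k\binom{4k}{2k}\equiv\begin{cases}17^{(p-3)/4}\pmod p&\text{if }p\equiv\pm1,\pm4\pmod{17},\\ -17^{(p-3)/4}\pmod p&\text{if }p\equiv\pm2,\pm8\pmod{17},\\ 4\cdot17^{(p-3)/4}\pmod p&\text{if }p\equiv\pm3,\pm5\pmod{17},\\ -4\cdot17^{(p-3)/4}\pmod p&\text{if }p\equiv\pm6,\pm7\pmod{17}.\end{cases}$$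
   Context: $[x]$ denotes the greatest integer not exceeding $x$. -}

module Defs where

open import Data.Nat using (ℕ; zero; suc; _+_; _*_; _/_; _%_)
open import Data.Nat.Combinatorics using (_C_)
open import Data.Integer using (ℤ; +_; -_; _-_) renaming (_+_ to _+ℤ_; _*_ to _*ℤ_)
open import Data.Integer.Divisibility using () renaming (_∣_ to _∣ℤ_)

sign : ℕ → ℤ
sign zero = + 1
sign (suc k) = - sign k

sumTo : ℕ → ℤ
sumTo zero = + 1
sumTo (suc n) = sumTo n +ℤ (sign (suc n) *ℤ (+ ((4 * suc n) C (2 * suc n))))

S : ℕ → ℤ
S p = sumTo (p / 4)

_≡_[mod_] : ℤ → ℤ → ℕ → Set
a ≡ b [mod m ] = (+ m) ∣ℤ (a - b)

{-# OPTIONS --safe #-}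
module Submission where

-- Write p = 2m + 1.  Since binom(2n, n) ≡ (−4)ⁿ binom(m, n) mod p, the sum is
-- congruent to Re (1 + 4i)ᵐ.  Let χ be a quartic character modulo 17 and put
-- τ = Σ χ(a) xᵃ and γ = − Σ χ(a)² xᵃ in the group ring of ℤ/17 over ℤ[i]/p.
-- Then τ² = (1 + 4i) γ, and γ² acts as 17 on τ and on γ, so that τᵖ and γᵖ
-- contain (1 + 4i)ᵐ and 17ᵐ.  On the other hand the Frobenius map gives
-- τᵖ = Σ χ(a)ᵖ xᵖᵃ, which depends only on p modulo 4 and modulo 17, and
-- likewise for γ.  Comparing the coefficients of x¹ determines (1 + 4i)ᵐ.

-- The number 1 + 4i, of norm 17, is minus the Jacobi sum of the quartic character with itself; this
-- is why a sum of powers of 4i sees p modulo 17. The group ring stands in for an extension of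
-- ℤ[i]/p by a 17th root of unity: equality there is equality of coefficients, so a congruence
-- modulo p can be read off directly. The price is that γ² is 17 minus the sum of all xᵃ, not 17.
-- That surplus kills every element whose coefficients sum to zero, so γ² is only ever applied to
-- such elements. With r = [p/4], τᵖ yields (1 + 4i)ᵐ only together with the factor 17ʳ; γᵖ serves
-- to remove it, by exhibiting 17ᵐ as 1 or -1 modulo p. In the end (1 + 4i)ᵐ is 17ʳ χ(p) if p ≡ 1
-- mod 4, and 17ʳ (1 - 4i) times the conjugate of χ(p) if p ≡ 3 mod 4. The residue classes modulo 17
-- in the theorem are grouped by the value of χ.

open import Level using (0ℓ)
open import Algebra.Bundles using (CommutativeSemiring)
open import Data.Fin using (Fin)
open import Data.Nat as ℕ using (ℕ; zero; suc)
import Data.Nat.Properties as ℕ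
import Data.Nat.Tactic.RingSolver as ℕ
open import Data.Nat.GeneralisedArithmetic using (fold)
open import Data.Nat.Primality using (Prime)
open import Relation.Binary.PropositionalEquality as ≡ using (_≡_)

-- Absorption and divisibility of binomial coefficients

module BinomialCoefficients where

  open import Data.Nat using (_+_; _*_; _<_; s≤s; z≤n)
  open import Data.Nat.Combinatorics using (_C_; k>n⇒nCk≡0; nCk+nC[k+1]≡[n+1]C[k+1])
  open import Data.Nat.Divisibility using (_∣_; m∣m*n; >⇒∤)
  open import Data.Nat.Primality using (euclidsLemma)
  open import Data.Sum using (inj₁; inj₂)
  open import Relation.Nullary using (contradiction)
  open import Relation.Binary.PropositionalEquality using (cong; cong₂; subst; module ≡-Reasoning)

  -- Absorption, kept as an equation between products so that no division occurs; the induction on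
  -- `n` runs through Pascal's rule.
  [k+1]*[n+1]C[k+1]≡[n+1]*nCk : ∀ n k → suc k * (suc n C suc k) ≡ suc n * (n C k)
  [k+1]*[n+1]C[k+1]≡[n+1]*nCk zero    zero    = ≡.refl
  [k+1]*[n+1]C[k+1]≡[n+1]*nCk zero    (suc k) = ≡.trans
    (cong (suc (suc k) *_) (k>n⇒nCk≡0 {1} {suc (suc k)} (s≤s (s≤s z≤n))))
    (ℕ.*-zeroʳ (suc (suc k)))
  [k+1]*[n+1]C[k+1]≡[n+1]*nCk (suc n) zero    = begin
    1 * (suc (suc n) C 1)             ≡⟨ ℕ.*-identityˡ _ ⟩
    suc (suc n) C 1                   ≡⟨ nCk+nC[k+1]≡[n+1]C[k+1] (suc n) 0 ⟨
    (suc n C 0) + (suc n C 1)         ≡⟨ cong (1 +_) (≡.trans (≡.sym (ℕ.*-identityˡ _)) ([k+1]*[n+1]C[k+1]≡[n+1]*nCk n 0)) ⟩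
    1 + suc n * (n C 0)               ≡⟨⟩
    suc (suc n) * (suc n C 0)         ∎
    where open ≡-Reasoning
  [k+1]*[n+1]C[k+1]≡[n+1]*nCk (suc n) (suc k) = begin
    suc (suc k) * (suc (suc n) C suc (suc k))
      ≡⟨ cong (suc (suc k) *_) (nCk+nC[k+1]≡[n+1]C[k+1] (suc n) (suc k)) ⟨
    suc (suc k) * (x + y)
      ≡⟨ expand k x y ⟩
    x + suc k * x + suc (suc k) * y
      ≡⟨ cong₂ (λ u v → x + u + v) ([k+1]*[n+1]C[k+1]≡[n+1]*nCk n k) ([k+1]*[n+1]C[k+1]≡[n+1]*nCk n (suc k)) ⟩
    x + suc n * (n C k) + suc n * (n C suc k)
      ≡⟨ ≡.trans (ℕ.+-assoc x _ _) (cong (x +_) (≡.sym (ℕ.*-distribˡ-+ (suc n) (n C k) (n C suc k)))) ⟩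
    x + suc n * ((n C k) + (n C suc k))
      ≡⟨ cong (λ u → x + suc n * u) (nCk+nC[k+1]≡[n+1]C[k+1] n k) ⟩
    suc (suc n) * x ∎
    where
    open ≡-Reasoning
    x = suc n C suc k
    y = suc n C suc (suc k)
    expand : ∀ k x y → suc (suc k) * (x + y) ≡ x + suc k * x + suc (suc k) * y
    expand = ℕ.solve-∀

  -- By absorption p divides `suc k` times the coefficient, and it cannot divide the positive,
  -- smaller number `suc k`.
  prime∣pC[k+1] : ∀ {p} k → Prime p → suc k < p → p ∣ p C suc k
  prime∣pC[k+1] {suc n} k p-prime k<p
    with euclidsLemma (suc k) (suc n C suc k) p-prime
           (subst (suc n ∣_) (≡.sym ([k+1]*[n+1]C[k+1]≡[n+1]*nCk n k)) (m∣m*n (n C k)))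
  ... | inj₁ p∣k = contradiction p∣k (>⇒∤ k<p)
  ... | inj₂ p∣C = p∣C

-- The p-th power map in characteristic p

module Frobenius {c ℓ} (R : CommutativeSemiring c ℓ) where

  open import Data.Fin as Fin using (toℕ; fromℕ; inject₁)
  open import Data.Fin.Properties using (toℕ-fromℕ; toℕ-inject₁; toℕ<n)
  open import Data.Nat using (_*_; _<_; s≤s)
  open import Data.Nat.Combinatorics using (_C_; nCn≡1)
  open import Data.Nat.Divisibility using (_∣_; divides)
  open import Data.Nat.Primality using (¬prime[0]; prime⇒nonZero)
  open import Function using (_∘_)
  open import Relation.Nullary using (contradiction)
  open import Relation.Binary.PropositionalEquality using (cong; subst)
  open BinomialCoefficients using (prime∣pC[k+1])
  open CommutativeSemiring R renaming (_+_ to _⊞_; _*_ to _⊠_)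
  open import Algebra.Properties.CommutativeSemiring.Binomial R using (binomialTerm; theorem)
  open import Algebra.Properties.Semiring.Exp semiring using (_^_)
  open import Algebra.Properties.Semiring.Mult semiring using (_×_; ×-assocˡ; ×-homo-1)
  open import Algebra.Properties.Semiring.Sum semiring using (sum; sum-cong-≋; sum-init-last; sum-replicate-zero)
  open import Relation.Binary.Reasoning.Setoid setoid

  module _ {p} (p-prime : Prime p) (p×x≈0 : ∀ x → p × x ≈ 0#) where

    multiple×≈0 : ∀ n x → p ∣ n → n × x ≈ 0#
    multiple×≈0 n x (divides q n≡qp) = begin
      n × x           ≡⟨ cong (_× x) (≡.trans n≡qp (ℕ.*-comm q p)) ⟩
      (p * q) × x     ≈⟨ ×-assocˡ x p q ⟨
      p × (q × x)     ≈⟨ p×x≈0 _ ⟩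
      0#              ∎

    -- Every inner binomial coefficient is a multiple of p and annihilates its term, so only the two
    -- ends of the expansion survive.
    ^p-homo-+ : ∀ x y → (x ⊞ y) ^ p ≈ x ^ p ⊞ y ^ p
    ^p-homo-+ x y = begin
      (x ⊞ y) ^ p                                ≈⟨ theorem p x y ⟩
      sum (term p)                               ≈⟨ split p p-prime ≡.refl ⟩
      y ^ p ⊞ (0# ⊞ x ^ p)                       ≈⟨ +-congˡ (+-identityˡ _) ⟩
      y ^ p ⊞ x ^ p                              ≈⟨ +-comm _ _ ⟩
      x ^ p ⊞ y ^ p                              ∎
      where
      term : (n : ℕ) → Fin (suc n) → Carrier
      term = binomialTerm x y

      middle : ∀ n → Prime (suc n) → p ≡ suc n → ∀ k → term (suc n) (Fin.suc (inject₁ {n} k)) ≈ 0#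
      middle n pr eq k = multiple×≈0 (suc n C suc (toℕ (inject₁ k))) _ (subst (_∣ _) (≡.sym eq)
        (prime∣pC[k+1] _ pr (s≤s (subst (_< n) (≡.sym (toℕ-inject₁ k)) (toℕ<n k)))))

      top : ∀ n → term (suc n) (Fin.suc (fromℕ n)) ≈ x ^ suc n
      top n rewrite toℕ-fromℕ n | nCn≡1 (suc n) | ℕ.n∸n≡0 n = trans (×-homo-1 _) (*-identityʳ _)

      -- The exponent is generalised to `n`, so that matching it as a successor exposes the first
      -- and last terms, while `p ≡ n` keeps the characteristic available.
      split : ∀ n → Prime n → p ≡ n → sum (term n) ≈ y ^ n ⊞ (0# ⊞ x ^ n)
      split zero pr _ = contradiction pr ¬prime[0]
      split (suc n) pr eq = +-cong
        (trans (×-homo-1 _) (*-identityˡ _))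
        (trans (sum-init-last (term (suc n) ∘ Fin.suc))
          (+-cong (trans (sum-cong-≋ (middle n pr eq)) (sum-replicate-zero n)) (top n)))

    ^p-homo-sum : ∀ {n} (f : Fin n → Carrier) → sum f ^ p ≈ sum (λ i → f i ^ p)
    ^p-homo-sum {zero}  f = 0^n≈0 p {{prime⇒nonZero p-prime}}
      where
      0^n≈0 : ∀ n → .{{ℕ.NonZero n}} → 0# ^ n ≈ 0#
      0^n≈0 (suc n) = zeroˡ _
    ^p-homo-sum {suc n} f = begin
      (f Fin.zero ⊞ sum (f ∘ Fin.suc)) ^ p       ≈⟨ ^p-homo-+ _ _ ⟩
      f Fin.zero ^ p ⊞ sum (f ∘ Fin.suc) ^ p     ≈⟨ +-congˡ (^p-homo-sum (f ∘ Fin.suc)) ⟩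
      sum (λ i → f i ^ p)                        ∎

-- A finite abelian group is presented by its subtraction, because the
-- convolution is written with _⊖_ only; these three laws suffice.
record IsSubtraction {n : ℕ} (_⊖_ : Fin n → Fin n → Fin n) (𝟘 : Fin n) : Set where
  field
    ⊖-identityʳ  : ∀ a → a ⊖ 𝟘 ≡ a
    ⊖-involutive : ∀ a b → a ⊖ (a ⊖ b) ≡ b
    ⊖-exchange   : ∀ a b c → (a ⊖ b) ⊖ c ≡ (a ⊖ c) ⊖ b

  _⊕_ : Fin n → Fin n → Fin n
  a ⊕ b = a ⊖ (𝟘 ⊖ b)

  _⊙_ : ℕ → Fin n → Fin n
  k ⊙ a = fold 𝟘 (a ⊕_) k

  k⊙𝟘≡𝟘 : ∀ k → k ⊙ 𝟘 ≡ 𝟘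
  k⊙𝟘≡𝟘 zero    = ≡.refl
  k⊙𝟘≡𝟘 (suc k) = ≡.trans (≡.cong (𝟘 ⊕_) (k⊙𝟘≡𝟘 k)) (⊖-involutive 𝟘 𝟘)

  open ≡.≡-Reasoning

  a⊖a≡𝟘 : ∀ a → a ⊖ a ≡ 𝟘
  a⊖a≡𝟘 a = ≡.trans (≡.cong (a ⊖_) (≡.sym (⊖-identityʳ a))) (⊖-involutive a 𝟘)

  a⊕[b⊖a]≡b : ∀ a b → a ⊕ (b ⊖ a) ≡ b
  a⊕[b⊖a]≡b a b = begin
    a ⊖ (𝟘 ⊖ (b ⊖ a))        ≡⟨ ≡.cong (λ z → a ⊖ (z ⊖ (b ⊖ a))) (a⊖a≡𝟘 b) ⟨
    a ⊖ ((b ⊖ b) ⊖ (b ⊖ a))  ≡⟨ ≡.cong (a ⊖_) (⊖-exchange b b (b ⊖ a)) ⟩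
    a ⊖ ((b ⊖ (b ⊖ a)) ⊖ b)  ≡⟨ ≡.cong (λ z → a ⊖ (z ⊖ b)) (⊖-involutive b a) ⟩
    a ⊖ (a ⊖ b)              ≡⟨ ⊖-involutive a b ⟩
    b                        ∎

  [a⊕b]⊖a≡b : ∀ a b → (a ⊕ b) ⊖ a ≡ b
  [a⊕b]⊖a≡b a b = begin
    (a ⊖ (𝟘 ⊖ b)) ⊖ a        ≡⟨ ⊖-exchange a (𝟘 ⊖ b) a ⟩
    (a ⊖ a) ⊖ (𝟘 ⊖ b)        ≡⟨ ≡.cong (_⊖ (𝟘 ⊖ b)) (a⊖a≡𝟘 a) ⟩
    𝟘 ⊖ (𝟘 ⊖ b)              ≡⟨ ⊖-involutive 𝟘 b ⟩
    b                        ∎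

-- The group ring as functions under convolution

module GroupSemiring {c ℓ} (R : CommutativeSemiring c ℓ)
  {n : ℕ} {_⊖_ : Fin n → Fin n → Fin n} {𝟘 : Fin n} (isSubtraction : IsSubtraction _⊖_ 𝟘) where

  open import Algebra.Structures.Biased using (isCommutativeSemiringˡ)
  open import Data.Bool using (if_then_else_)
  open import Data.Fin using (zero; suc)
  open import Data.Fin.Properties using (_≟_)
  open import Data.Fin.Permutation using (permutation)
  open import Function using (_∘_)
  open import Relation.Nullary using (does; yes; no; contradiction)
  open IsSubtraction isSubtraction
  open CommutativeSemiring R hiding (zero)
  open import Algebra.Properties.Semiring.Sum semiring
    using (sum; sum-cong-≋; sum-replicate-zero; ∑-distrib-+; *-distribˡ-sum; ∑-comm; sum-permute)
  open import Algebra.Properties.Semiring.Exp semiring using (_^_)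
  open import Algebra.Properties.Semiring.Mult semiring using (_×_)
  open import Relation.Binary.Reasoning.Setoid setoid

  Element : Set c
  Element = Fin n → Carrier

  infix 4 _≋_
  -- A record keeps `f` and `g` visible as parameters; they could not be inferred from pointwise
  -- equations alone.
  record _≋_ (f g : Element) : Set ℓ where
    constructor pointwise
    field at : ∀ a → f a ≈ g a
  open _≋_ public

  infixl 6 _+ᴳ_
  _+ᴳ_ : Element → Element → Element
  (f +ᴳ g) a = f a + g a

  infixl 7 _*ᴳ_
  _*ᴳ_ : Element → Element → Element
  (f *ᴳ g) a = sum (λ b → f b * g (a ⊖ b))

  monomial : Carrier → Fin n → Element
  monomial x a b = if does (a ≟ b) then x else 0#

  0ᴳ 1ᴳ : Element
  0ᴳ _ = 0#
  1ᴳ = monomial 1# 𝟘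

  sum≈0 : ∀ {m} (f : Fin m → Carrier) → (∀ a → f a ≈ 0#) → sum f ≈ 0#
  sum≈0 {m} f f≈0 = trans (sum-cong-≋ f≈0) (sum-replicate-zero m)

  monomial-cong : ∀ {x y} a → x ≈ y → monomial x a ≋ monomial y a
  monomial-cong {x} {y} a x≈y .at b with a ≟ b
  ... | yes _ = x≈y
  ... | no  _ = refl

  sum-select : ∀ {m} a (f : Fin m → Carrier) →
    sum (λ b → if does (a ≟ b) then f b else 0#) ≈ f a
  sum-select {suc m} zero f = trans (+-congˡ (sum-replicate-zero m)) (+-identityʳ _)
  sum-select (suc a) f = trans (+-identityˡ _) (sum-select a (f ∘ suc))

  sum-select′ : ∀ {m} a (f : Fin m → Carrier) →
    sum (λ b → if does (b ≟ a) then f b else 0#) ≈ f a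
  sum-select′ {suc m} zero f = trans (+-congˡ (sum-replicate-zero m)) (+-identityʳ _)
  sum-select′ (suc a) f = trans (+-identityˡ _) (sum-select′ a (f ∘ suc))

  monomial-*-at : ∀ x a f b → (monomial x a *ᴳ f) b ≈ x * f (b ⊖ a)
  monomial-*-at x a f b = trans (sum-cong-≋ pull) (sum-select a (λ e → x * f (b ⊖ e)))
    where
    pull : ∀ e → monomial x a e * f (b ⊖ e) ≈ (if does (a ≟ e) then x * f (b ⊖ e) else 0#)
    pull e with a ≟ e
    ... | yes _ = refl
    ... | no  _ = zeroˡ _

  monomial-*-monomial : ∀ x a y b → monomial x a *ᴳ monomial y b ≋ monomial (x * y) (a ⊕ b)
  monomial-*-monomial x a y b .at e = trans (monomial-*-at x a (monomial y b) e) shifted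
    where
    shifted : x * monomial y b (e ⊖ a) ≈ monomial (x * y) (a ⊕ b) e
    shifted with b ≟ e ⊖ a | a ⊕ b ≟ e
    ... | yes _    | yes _    = refl
    ... | no  _    | no  _    = zeroʳ _
    -- The mixed cases are impossible because `b ≡ e ⊖ a` and `a ⊕ b ≡ e` are equivalent.
    ... | yes ≡.refl | no a⊕b≢e = contradiction (a⊕[b⊖a]≡b a e) a⊕b≢e
    ... | no b≢e⊖a | yes ≡.refl = contradiction (≡.sym ([a⊕b]⊖a≡b a b)) b≢e⊖a

  -- For fixed `a` the map `b ↦ a ⊖ b` is an involution of the index set, and reindexing by it swaps
  -- the two factors.
  *ᴳ-comm : ∀ f g → f *ᴳ g ≋ g *ᴳ f
  *ᴳ-comm f g .at a = begin
    sum (λ b → f b * g (a ⊖ b))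
      ≈⟨ sum-permute _ (permutation (a ⊖_) (a ⊖_) (⊖-involutive a) (⊖-involutive a)) ⟩
    sum (λ b → f (a ⊖ b) * g (a ⊖ (a ⊖ b)))
      ≈⟨ sum-cong-≋ (λ b → trans (*-congˡ (reflexive (≡.cong g (⊖-involutive a b)))) (*-comm _ _)) ⟩
    sum (λ b → g b * f (a ⊖ b)) ∎

  *ᴳ-cong : ∀ {f f′ g g′} → f ≋ f′ → g ≋ g′ → f *ᴳ g ≋ f′ *ᴳ g′
  *ᴳ-cong f≋f′ g≋g′ .at a = sum-cong-≋ λ b → *-cong (f≋f′ .at b) (g≋g′ .at (a ⊖ b))

  -- Exchanging the two summations needs only `⊖-exchange`, without a change of index; with
  -- commutativity it gives associativity.
  *ᴳ-exchange : ∀ f g h → f *ᴳ (g *ᴳ h) ≋ g *ᴳ (f *ᴳ h)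
  *ᴳ-exchange f g h .at a = begin
    sum (λ b → f b * sum (λ e → g e * h ((a ⊖ b) ⊖ e)))
      ≈⟨ sum-cong-≋ (λ b → *-distribˡ-sum (f b) (λ e → g e * h ((a ⊖ b) ⊖ e))) ⟩
    sum (λ b → sum (λ e → f b * (g e * h ((a ⊖ b) ⊖ e))))
      ≈⟨ ∑-comm (λ b e → f b * (g e * h ((a ⊖ b) ⊖ e))) ⟩
    sum (λ e → sum (λ b → f b * (g e * h ((a ⊖ b) ⊖ e))))
      ≈⟨ sum-cong-≋ (λ e → sum-cong-≋ (swap e)) ⟩
    sum (λ e → sum (λ b → g e * (f b * h ((a ⊖ e) ⊖ b))))
      ≈⟨ sum-cong-≋ (λ e → *-distribˡ-sum (g e) (λ b → f b * h ((a ⊖ e) ⊖ b))) ⟨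
    sum (λ e → g e * sum (λ b → f b * h ((a ⊖ e) ⊖ b))) ∎
    where
    swap : ∀ e b → f b * (g e * h ((a ⊖ b) ⊖ e)) ≈ g e * (f b * h ((a ⊖ e) ⊖ b))
    swap e b = begin
      f b * (g e * h ((a ⊖ b) ⊖ e))  ≈⟨ *-assoc _ _ _ ⟨
      (f b * g e) * h ((a ⊖ b) ⊖ e)  ≈⟨ *-cong (*-comm _ _) (reflexive (≡.cong h (⊖-exchange a b e))) ⟩
      (g e * f b) * h ((a ⊖ e) ⊖ b)  ≈⟨ *-assoc _ _ _ ⟩
      g e * (f b * h ((a ⊖ e) ⊖ b))  ∎

  ≋-refl : ∀ {f} → f ≋ f
  ≋-refl .at _ = refl

  ≋-sym : ∀ {f g} → f ≋ g → g ≋ f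
  ≋-sym f≋g .at a = sym (f≋g .at a)

  ≋-trans : ∀ {f g h} → f ≋ g → g ≋ h → f ≋ h
  ≋-trans f≋g g≋h .at a = trans (f≋g .at a) (g≋h .at a)

  *ᴳ-assoc : ∀ f g h → (f *ᴳ g) *ᴳ h ≋ f *ᴳ (g *ᴳ h)
  *ᴳ-assoc f g h = ≋-trans (*ᴳ-comm (f *ᴳ g) h)
    (≋-trans (*ᴳ-exchange h f g) (*ᴳ-cong (≋-refl {f}) (*ᴳ-comm h g)))

  *ᴳ-identityˡ : ∀ f → 1ᴳ *ᴳ f ≋ f
  *ᴳ-identityˡ f .at a = trans (monomial-*-at 1# 𝟘 f a)
    (trans (*-identityˡ _) (reflexive (≡.cong f (⊖-identityʳ a))))

  *ᴳ-distribʳ : ∀ f g h → (g +ᴳ h) *ᴳ f ≋ g *ᴳ f +ᴳ h *ᴳ f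
  *ᴳ-distribʳ f g h .at a = trans (sum-cong-≋ (λ b → distribʳ (f (a ⊖ b)) (g b) (h b)))
    (∑-distrib-+ (λ b → g b * f (a ⊖ b)) (λ b → h b * f (a ⊖ b)))

  *ᴳ-zeroˡ : ∀ f → 0ᴳ *ᴳ f ≋ 0ᴳ
  *ᴳ-zeroˡ f .at a = sum≈0 (λ b → 0# * f (a ⊖ b)) λ _ → zeroˡ _

  commutativeSemiring : CommutativeSemiring c ℓ
  commutativeSemiring = record
    { Carrier = Element
    ; _≈_ = _≋_
    ; _+_ = _+ᴳ_
    ; _*_ = _*ᴳ_
    ; 0# = 0ᴳ
    ; 1# = 1ᴳ
    ; isCommutativeSemiring = isCommutativeSemiringˡ record
      { +-isCommutativeMonoid = record
        { isMonoid = record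
          { isSemigroup = record
            { isMagma = record
              { isEquivalence = record { refl = ≋-refl ; sym = ≋-sym ; trans = ≋-trans }
              ; ∙-cong = λ f≋f′ g≋g′ → pointwise λ a → +-cong (f≋f′ .at a) (g≋g′ .at a)
              }
            ; assoc = λ f g h → pointwise λ a → +-assoc (f a) (g a) (h a)
            }
          ; identity = (λ f → pointwise λ a → +-identityˡ (f a)) , (λ f → pointwise λ a → +-identityʳ (f a))
          }
        ; comm = λ f g → pointwise λ a → +-comm (f a) (g a)
        }
      ; *-isCommutativeMonoid = record
        { isMonoid = record
          { isSemigroup = record
            { isMagma = record
              { isEquivalence = record { refl = ≋-refl ; sym = ≋-sym ; trans = ≋-trans }
              ; ∙-cong = *ᴳ-cong
              }
            ; assoc = *ᴳ-assoc
            }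
          ; identity = *ᴳ-identityˡ , λ f → ≋-trans (*ᴳ-comm f 1ᴳ) (*ᴳ-identityˡ f)
          }
        ; comm = *ᴳ-comm
        }
      ; distribʳ = *ᴳ-distribʳ
      ; zeroˡ = *ᴳ-zeroˡ
      }
    }
    where open import Data.Product using (_,_)

  private module G = CommutativeSemiring commutativeSemiring
  open import Algebra.Properties.Semiring.Exp G.semiring using () renaming (_^_ to _^ᴳ_; ^-congˡ to ^ᴳ-congˡ)
  open import Algebra.Properties.Semiring.Mult G.semiring using () renaming (_×_ to _×ᴳ_)
  open import Algebra.Properties.Semiring.Sum G.semiring using () renaming (sum to sumᴳ)

  ×ᴳ-at : ∀ k f a → (k ×ᴳ f) a ≡ k × f a
  ×ᴳ-at zero    f a = ≡.refl
  ×ᴳ-at (suc k) f a = ≡.cong (f a +_) (×ᴳ-at k f a)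

  sumᴳ-at : ∀ {m} (f : Fin m → Element) a → sumᴳ f a ≡ sum (λ b → f b a)
  sumᴳ-at {zero}  f a = ≡.refl
  sumᴳ-at {suc m} f a = ≡.cong (f zero a +_) (sumᴳ-at (f ∘ suc) a)

  monomial-^ : ∀ x a k → monomial x a ^ᴳ k ≋ monomial (x ^ k) (k ⊙ a)
  monomial-^ x a zero    = ≋-refl
  monomial-^ x a (suc k) = ≋-trans (*ᴳ-cong ≋-refl (monomial-^ x a k)) (monomial-*-monomial x a (x ^ k) (k ⊙ a))

  constant : Carrier → Element
  constant x = monomial x 𝟘

  constant^-*-at : ∀ x k f b → ((constant x ^ᴳ k) *ᴳ f) b ≈ x ^ k * f b
  constant^-*-at x k f b = begin
    ((constant x ^ᴳ k) *ᴳ f) b           ≈⟨ *ᴳ-cong (monomial-^ x 𝟘 k) (≋-refl {f}) .at b ⟩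
    (monomial (x ^ k) (k ⊙ 𝟘) *ᴳ f) b    ≈⟨ monomial-*-at (x ^ k) (k ⊙ 𝟘) f b ⟩
    x ^ k * f (b ⊖ (k ⊙ 𝟘))              ≡⟨ ≡.cong (λ a → x ^ k * f (b ⊖ a)) (k⊙𝟘≡𝟘 k) ⟩
    x ^ k * f (b ⊖ 𝟘)                    ≡⟨ ≡.cong (λ a → x ^ k * f a) (⊖-identityʳ b) ⟩
    x ^ k * f b                          ∎

  monomial-expansion : ∀ f → f ≋ sumᴳ (λ a → monomial (f a) a)
  monomial-expansion f .at b = sym (trans (reflexive (sumᴳ-at (λ a → monomial (f a) a) b)) (sum-select′ b f))

  module _ {p} (p-prime : Prime p) (p×x≈0 : ∀ x → p × x ≈ 0#) where

    open Frobenius commutativeSemiring using (^p-homo-sum)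

    -- Expanded into monomials, `f` is raised to the power p term by term: the coefficient goes to
    -- its p-th power and the group element to its p-fold multiple.
    ^p-at : ∀ f b → (f ^ᴳ p) b ≈ sum (λ a → monomial (f a ^ p) (p ⊙ a) b)
    ^p-at f b = begin
      (f ^ᴳ p) b                                        ≈⟨ ^ᴳ-congˡ p (monomial-expansion f) .at b ⟩
      (sumᴳ (λ a → monomial (f a) a) ^ᴳ p) b            ≈⟨ ^p-homo-sum p-prime p×f≋0 (λ a → monomial (f a) a) .at b ⟩
      sumᴳ (λ a → monomial (f a) a ^ᴳ p) b              ≡⟨ sumᴳ-at (λ a → monomial (f a) a ^ᴳ p) b ⟩
      sum (λ a → (monomial (f a) a ^ᴳ p) b)             ≈⟨ sum-cong-≋ (λ a → monomial-^ (f a) a p .at b) ⟩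
      sum (λ a → monomial (f a ^ p) (p ⊙ a) b)          ∎
      where
      p×f≋0 : ∀ g → p ×ᴳ g ≋ 0ᴳ
      p×f≋0 g .at a = trans (reflexive (×ᴳ-at p g a)) (p×x≈0 (g a))

open import Data.Integer as ℤ using (ℤ; +_; -[1+_])
import Data.Integer.Properties as ℤ
import Data.Integer.Tactic.RingSolver as ℤ

-- Congruence of integers

module Congruence (n : ℕ) where

  open import Data.Integer using (-_; _+_; _*_; _-_)
  open import Data.Integer.Divisibility.Signed using (_∣_; divides; ∣m∣n⇒∣m+n; ∣m⇒∣-m; ∣n⇒∣m*n; ∣m⇒∣m*n)
  open import Data.Integer.Properties using (+-inverseʳ)
  open import Data.Integer.Tactic.RingSolver using (solve-∀)
  open import Relation.Binary.Bundles using (Setoid)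

  infix 4 _≈_
  -- The record remembers both sides, which the divisibility of their difference does not determine.
  record _≈_ (x y : ℤ) : Set where
    constructor congruent
    field n∣x-y : + n ∣ x - y
  open _≈_ public

  reflexive : ∀ {x y} → x ≡ y → x ≈ y
  reflexive {x} ≡.refl = congruent (divides (+ 0) (+-inverseʳ x))

  refl : ∀ {x} → x ≈ x
  refl = reflexive ≡.refl

  sym : ∀ {x y} → x ≈ y → y ≈ x
  sym {x} {y} (congruent d) = congruent (≡.subst (+ n ∣_) (identity x y) (∣m⇒∣-m d))
    where
    identity : ∀ x y → - (x - y) ≡ y - x
    identity = solve-∀

  trans : ∀ {x y z} → x ≈ y → y ≈ z → x ≈ z
  trans {x} {y} {z} (congruent d) (congruent e) = congruent (≡.subst (+ n ∣_) (identity x y z) (∣m∣n⇒∣m+n d e))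
    where
    identity : ∀ x y z → (x - y) + (y - z) ≡ x - z
    identity = solve-∀

  +-cong : ∀ {x y u v} → x ≈ y → u ≈ v → x + u ≈ y + v
  +-cong {x} {y} {u} {v} (congruent d) (congruent e) =
    congruent (≡.subst (+ n ∣_) (identity x y u v) (∣m∣n⇒∣m+n d e))
    where
    identity : ∀ x y u v → (x - y) + (u - v) ≡ (x + u) - (y + v)
    identity = solve-∀

  *-cong : ∀ {x y u v} → x ≈ y → u ≈ v → x * u ≈ y * v
  *-cong {x} {y} {u} {v} (congruent d) (congruent e) =
    congruent (≡.subst (+ n ∣_) (identity x y u v) (∣m∣n⇒∣m+n (∣n⇒∣m*n x e) (∣m⇒∣m*n v d)))
    where
    identity : ∀ x y u v → x * (u - v) + (x - y) * v ≡ x * u - y * v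
    identity = solve-∀

  -‿cong : ∀ {x y} → x ≈ y → - x ≈ - y
  -‿cong {x} {y} (congruent d) = congruent (≡.subst (+ n ∣_) (identity x y) (∣m⇒∣-m d))
    where
    identity : ∀ x y → - (x - y) ≡ (- x) - (- y)
    identity = solve-∀

  multiple≈0 : ∀ x → + n * x ≈ + 0
  multiple≈0 x = congruent (divides x (identity (+ n) x))
    where
    identity : ∀ k x → k * x - + 0 ≡ x * k
    identity = solve-∀

  setoid : Setoid 0ℓ 0ℓ
  setoid = record { _≈_ = _≈_ ; isEquivalence = record { refl = refl ; sym = sym ; trans = trans } }

-- Gaussian integers, exactly and modulo n

module GaussianIntegers where

  open import Algebra.Structures.Biased using (isCommutativeSemiringˡ)
  open import Data.Integer.Tactic.RingSolver using (solve-∀)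
  open import Data.Product using (_,_)
  open import Relation.Binary using (DecidableEquality)
  open import Relation.Nullary.Decidable using (map′; _×-dec_)

  record ℤ[i] : Set where
    constructor ⟨_,_⟩
    field re im : ℤ
  open ℤ[i] public

  infixl 6 _+_
  _+_ : ℤ[i] → ℤ[i] → ℤ[i]
  ⟨ a , b ⟩ + ⟨ c , d ⟩ = ⟨ a ℤ.+ c , b ℤ.+ d ⟩

  infixl 7 _*_
  _*_ : ℤ[i] → ℤ[i] → ℤ[i]
  ⟨ a , b ⟩ * ⟨ c , d ⟩ = ⟨ a ℤ.* c ℤ.- b ℤ.* d , a ℤ.* d ℤ.+ b ℤ.* c ⟩

  0# 1# : ℤ[i]
  0# = ⟨ + 0 , + 0 ⟩
  1# = ⟨ + 1 , + 0 ⟩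

  _≟_ : DecidableEquality ℤ[i]
  ⟨ a , b ⟩ ≟ ⟨ c , d ⟩ = map′ (λ { (≡.refl , ≡.refl) → ≡.refl }) (λ { ≡.refl → ≡.refl , ≡.refl })
    (a ℤ.≟ c ×-dec b ℤ.≟ d)

  *-assoc : ∀ x y z → (x * y) * z ≡ x * (y * z)
  *-assoc ⟨ a , b ⟩ ⟨ c , d ⟩ ⟨ e , f ⟩ = ≡.cong₂ ⟨_,_⟩ (real a b c d e f) (imag a b c d e f)
    where
    real : ∀ a b c d e f → (a ℤ.* c ℤ.- b ℤ.* d) ℤ.* e ℤ.- (a ℤ.* d ℤ.+ b ℤ.* c) ℤ.* f
                         ≡ a ℤ.* (c ℤ.* e ℤ.- d ℤ.* f) ℤ.- b ℤ.* (c ℤ.* f ℤ.+ d ℤ.* e)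
    real = solve-∀
    imag : ∀ a b c d e f → (a ℤ.* c ℤ.- b ℤ.* d) ℤ.* f ℤ.+ (a ℤ.* d ℤ.+ b ℤ.* c) ℤ.* e
                         ≡ a ℤ.* (c ℤ.* f ℤ.+ d ℤ.* e) ℤ.+ b ℤ.* (c ℤ.* e ℤ.- d ℤ.* f)
    imag = solve-∀

  *-comm : ∀ x y → x * y ≡ y * x
  *-comm ⟨ a , b ⟩ ⟨ c , d ⟩ = ≡.cong₂ ⟨_,_⟩ (real a b c d) (imag a b c d)
    where
    real : ∀ a b c d → a ℤ.* c ℤ.- b ℤ.* d ≡ c ℤ.* a ℤ.- d ℤ.* b
    real = solve-∀
    imag : ∀ a b c d → a ℤ.* d ℤ.+ b ℤ.* c ≡ c ℤ.* b ℤ.+ d ℤ.* a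
    imag = solve-∀

  *-identityˡ : ∀ x → 1# * x ≡ x
  *-identityˡ ⟨ a , b ⟩ = ≡.cong₂ ⟨_,_⟩ (real a b) (imag a b)
    where
    real : ∀ a b → + 1 ℤ.* a ℤ.- + 0 ℤ.* b ≡ a
    real = solve-∀
    imag : ∀ a b → + 1 ℤ.* b ℤ.+ + 0 ℤ.* a ≡ b
    imag = solve-∀

  *-zeroˡ : ∀ x → 0# * x ≡ 0#
  *-zeroˡ x = ≡.refl

  *-distribʳ-+ : ∀ x y z → (y + z) * x ≡ y * x + z * x
  *-distribʳ-+ ⟨ a , b ⟩ ⟨ c , d ⟩ ⟨ e , f ⟩ = ≡.cong₂ ⟨_,_⟩ (real a b c d e f) (imag a b c d e f)
    where
    real : ∀ a b c d e f → (c ℤ.+ e) ℤ.* a ℤ.- (d ℤ.+ f) ℤ.* b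
                         ≡ (c ℤ.* a ℤ.- d ℤ.* b) ℤ.+ (e ℤ.* a ℤ.- f ℤ.* b)
    real = solve-∀
    imag : ∀ a b c d e f → (c ℤ.+ e) ℤ.* b ℤ.+ (d ℤ.+ f) ℤ.* a
                         ≡ (c ℤ.* b ℤ.+ d ℤ.* a) ℤ.+ (e ℤ.* b ℤ.+ f ℤ.* a)
    imag = solve-∀

  module Modulo (n : ℕ) where

    module ≈ℤ = Congruence n

    infix 4 _≈_
    -- The quotient keeps the carrier ℤ[i] and only coarsens equality. An identity of Gaussian
    -- integers verified by evaluation therefore holds for every modulus at once.
    record _≈_ (x y : ℤ[i]) : Set where
      constructor ⟨_,_⟩
      field
        re-cong : re x ≈ℤ.≈ re y
        im-cong : im x ≈ℤ.≈ im y
    open _≈_ public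

    reflexive : ∀ {x y} → x ≡ y → x ≈ y
    reflexive ≡.refl = ⟨ ≈ℤ.refl , ≈ℤ.refl ⟩

    commutativeSemiring : CommutativeSemiring 0ℓ 0ℓ
    commutativeSemiring = record
      { Carrier = ℤ[i]
      ; _≈_ = _≈_
      ; _+_ = _+_
      ; _*_ = _*_
      ; 0# = 0#
      ; 1# = 1#
      ; isCommutativeSemiring = isCommutativeSemiringˡ record
        { +-isCommutativeMonoid = record
          { isMonoid = record
            { isSemigroup = record
              { isMagma = record
                { isEquivalence = isEquivalence
                ; ∙-cong = λ x≈y u≈v → ⟨ ≈ℤ.+-cong (re-cong x≈y) (re-cong u≈v) , ≈ℤ.+-cong (im-cong x≈y) (im-cong u≈v) ⟩
                }
              ; assoc = λ x y z → reflexive (≡.cong₂ ⟨_,_⟩ (ℤ.+-assoc (re x) (re y) (re z)) (ℤ.+-assoc (im x) (im y) (im z)))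
              }
            ; identity = (λ x → reflexive (≡.cong₂ ⟨_,_⟩ (ℤ.+-identityˡ (re x)) (ℤ.+-identityˡ (im x))))
                       , (λ x → reflexive (≡.cong₂ ⟨_,_⟩ (ℤ.+-identityʳ (re x)) (ℤ.+-identityʳ (im x))))
            }
          ; comm = λ x y → reflexive (≡.cong₂ ⟨_,_⟩ (ℤ.+-comm (re x) (re y)) (ℤ.+-comm (im x) (im y)))
          }
        ; *-isCommutativeMonoid = record
          { isMonoid = record
            { isSemigroup = record
              { isMagma = record
                { isEquivalence = isEquivalence
                ; ∙-cong = λ x≈y u≈v →
                    ⟨ ≈ℤ.+-cong (≈ℤ.*-cong (re-cong x≈y) (re-cong u≈v)) (≈ℤ.-‿cong (≈ℤ.*-cong (im-cong x≈y) (im-cong u≈v)))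
                    , ≈ℤ.+-cong (≈ℤ.*-cong (re-cong x≈y) (im-cong u≈v)) (≈ℤ.*-cong (im-cong x≈y) (re-cong u≈v)) ⟩
                }
              ; assoc = λ x y z → reflexive (*-assoc x y z)
              }
            ; identity = (λ x → reflexive (*-identityˡ x))
                       , (λ x → reflexive (≡.trans (*-comm x 1#) (*-identityˡ x)))
            }
          ; comm = λ x y → reflexive (*-comm x y)
          }
        ; distribʳ = λ x y z → reflexive (*-distribʳ-+ x y z)
        ; zeroˡ = λ x → reflexive (*-zeroˡ x)
        }
      }
      where
      open import Relation.Binary using (IsEquivalence)
      isEquivalence : IsEquivalence _≈_
      isEquivalence = record
        { refl = ⟨ ≈ℤ.refl , ≈ℤ.refl ⟩
        ; sym = λ x≈y → ⟨ ≈ℤ.sym (re-cong x≈y) , ≈ℤ.sym (im-cong x≈y) ⟩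
        ; trans = λ x≈y y≈z → ⟨ ≈ℤ.trans (re-cong x≈y) (re-cong y≈z) , ≈ℤ.trans (im-cong x≈y) (im-cong y≈z) ⟩
        }

    open import Algebra.Properties.Semiring.Mult (CommutativeSemiring.semiring commutativeSemiring) using (_×_)

    ×-components : ∀ k x → k × x ≡ ⟨ + k ℤ.* re x , + k ℤ.* im x ⟩
    ×-components zero    x = ≡.refl
    ×-components (suc k) x rewrite ×-components k x =
      ≡.cong₂ ⟨_,_⟩ (≡.sym (ℤ.suc-* (+ k) (re x))) (≡.sym (ℤ.suc-* (+ k) (im x)))

    n×x≈0 : ∀ x → n × x ≈ 0#
    n×x≈0 x rewrite ×-components n x = ⟨ ≈ℤ.multiple≈0 (re x) , ≈ℤ.multiple≈0 (im x) ⟩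

-- From central binomial coefficients to powers of 1 + 4i

module BinomialSums where

  open import Defs using (sign; sumTo)
  open import Data.Integer using (-_; _+_; _*_; _-_; ∣_∣)
  open import Data.Integer.Divisibility.Signed using (∣ᵤ⇒∣; ∣⇒∣ᵤ)
  open import Data.Integer.Properties using (pos-+; pos-*; *-zeroʳ; abs-*)
  open import Data.Integer.Tactic.RingSolver using (solve-∀)
  open import Data.Nat.Combinatorics using (_C_; nCk≡nC[n∸k]; k>n⇒nCk≡0; nCk+nC[k+1]≡[n+1]C[k+1])
  open import Data.Nat.Divisibility using (>⇒∤)
  open import Data.Nat.Primality using (euclidsLemma)
  open import Data.Sum using (inj₁; inj₂)
  open import Relation.Nullary using (contradiction)
  open BinomialCoefficients using ([k+1]*[n+1]C[k+1]≡[n+1]*nCk)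
  open GaussianIntegers using (⟨_,_⟩)

  [-4]^ : ℕ → ℤ
  [-4]^ zero    = + 1
  [-4]^ (suc k) = - + 4 * [-4]^ k

  term : ℕ → ℕ → ℤ
  term m k = [-4]^ k * + (m C k)

  -- Absorption twice, with the symmetry of row 2n + 1 between its two middle entries.
  [n+1]*centralBinomial : ∀ n → suc n ℕ.* ((2 ℕ.* suc n) C suc n) ≡ (2 ℕ.* suc (2 ℕ.* n)) ℕ.* ((2 ℕ.* n) C n)
  [n+1]*centralBinomial n = begin
    suc n ℕ.* ((2 ℕ.* suc n) C suc n)               ≡⟨ ≡.cong (λ j → suc n ℕ.* (j C suc n)) (ℕ.*-suc 2 n) ⟩
    suc n ℕ.* (suc (suc (2 ℕ.* n)) C suc n)         ≡⟨ [k+1]*[n+1]C[k+1]≡[n+1]*nCk (suc (2 ℕ.* n)) n ⟩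
    suc (suc (2 ℕ.* n)) ℕ.* (suc (2 ℕ.* n) C n)     ≡⟨ ≡.cong (ℕ._* (suc (2 ℕ.* n) C n)) (≡.sym (ℕ.*-suc 2 n)) ⟩
    2 ℕ.* suc n ℕ.* (suc (2 ℕ.* n) C n)             ≡⟨ ℕ.*-assoc 2 (suc n) _ ⟩
    2 ℕ.* (suc n ℕ.* (suc (2 ℕ.* n) C n))           ≡⟨ ≡.cong (λ j → 2 ℕ.* (suc n ℕ.* j)) symmetric ⟩
    2 ℕ.* (suc n ℕ.* (suc (2 ℕ.* n) C suc n))       ≡⟨ ≡.cong (2 ℕ.*_) ([k+1]*[n+1]C[k+1]≡[n+1]*nCk (2 ℕ.* n) n) ⟩
    2 ℕ.* (suc (2 ℕ.* n) ℕ.* ((2 ℕ.* n) C n))       ≡⟨ ℕ.*-assoc 2 (suc (2 ℕ.* n)) _ ⟨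
    (2 ℕ.* suc (2 ℕ.* n)) ℕ.* ((2 ℕ.* n) C n)       ∎
    where
    open ≡.≡-Reasoning
    symmetric : suc (2 ℕ.* n) C n ≡ suc (2 ℕ.* n) C suc n
    symmetric = ≡.trans (nCk≡nC[n∸k] {n} {suc (2 ℕ.* n)} (ℕ.m≤n⇒m≤1+n (ℕ.m≤n*m n 2)))
      (≡.cong (suc (2 ℕ.* n) C_) (≡.trans (≡.cong (ℕ._∸ n) (split n)) (ℕ.m+n∸n≡m (suc n) n)))
      where
      split : ∀ n → suc (2 ℕ.* n) ≡ suc n ℕ.+ n
      split = ℕ.solve-∀

  -- The ratio m - k of consecutive coefficients in additive form, which stays correct for k > m,
  -- where natural subtraction would truncate.
  [k+1]*mC[k+1] : ∀ m k → suc k ℕ.* (m C suc k) ℕ.+ k ℕ.* (m C k) ≡ m ℕ.* (m C k)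
  [k+1]*mC[k+1] m k = ℕ.+-cancelˡ-≡ (m C k) _ _ (begin
    y ℕ.+ (suc k ℕ.* z ℕ.+ k ℕ.* y)   ≡⟨ factor k y z ⟩
    suc k ℕ.* (y ℕ.+ z)               ≡⟨ ≡.cong (suc k ℕ.*_) (nCk+nC[k+1]≡[n+1]C[k+1] m k) ⟩
    suc k ℕ.* (suc m C suc k)         ≡⟨ [k+1]*[n+1]C[k+1]≡[n+1]*nCk m k ⟩
    suc m ℕ.* y                       ∎)
    where
    open ≡.≡-Reasoning
    y = m C k
    z = m C suc k
    factor : ∀ k y z → y ℕ.+ (suc k ℕ.* z ℕ.+ k ℕ.* y) ≡ suc k ℕ.* (y ℕ.+ z)
    factor = ℕ.solve-∀

  m*mCk-k*mCk : ∀ m k → + m * + (m C k) - + k * + (m C k) ≡ + suc k * + (m C suc k)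
  m*mCk-k*mCk m k = begin
    + m * y - + k * y                                     ≡⟨ ≡.cong (_- + k * y) (pos-* m (m C k)) ⟨
    + (m ℕ.* (m C k)) - + k * y                           ≡⟨ ≡.cong (λ u → + u - + k * y) ([k+1]*mC[k+1] m k) ⟨
    + (suc k ℕ.* (m C suc k) ℕ.+ k ℕ.* (m C k)) - + k * y ≡⟨ ≡.cong (_- + k * y) (pos-+ (suc k ℕ.* (m C suc k)) (k ℕ.* (m C k))) ⟩
    + (suc k ℕ.* (m C suc k)) + + (k ℕ.* (m C k)) - + k * y
      ≡⟨ ≡.cong₂ (λ u v → u + v - + k * y) (pos-* (suc k) (m C suc k)) (pos-* k (m C k)) ⟩
    + suc k * + (m C suc k) + + k * y - + k * y           ≡⟨ cancel (+ suc k * + (m C suc k)) (+ k * y) ⟩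
    + suc k * + (m C suc k)                               ∎
    where
    open ≡.≡-Reasoning
    y = + (m C k)
    cancel : ∀ u v → u + v - v ≡ u
    cancel = solve-∀

  module _ {m} (p-prime : Prime (suc (2 ℕ.* m))) where

    open Congruence (suc (2 ℕ.* m))

    -- A positive factor below p is prime to p, so Euclid's lemma removes it.
    *-cancelˡ : ∀ {n x y} → suc n ℕ.< suc (2 ℕ.* m) → + suc n * x ≈ + suc n * y → x ≈ y
    *-cancelˡ {n} {x} {y} n<p (congruent d)
      with euclidsLemma (suc n) ∣ x - y ∣ p-prime (≡.subst (_ ℕ.∣_) abs-product (∣⇒∣ᵤ d))
      where
      import Data.Nat.Divisibility as ℕ
      factor : ∀ k x y → k * x - k * y ≡ k * (x - y)
      factor = solve-∀
      abs-product : ∣ + suc n * x - + suc n * y ∣ ≡ suc n ℕ.* ∣ x - y ∣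
      abs-product = ≡.trans (≡.cong ∣_∣ (factor (+ suc n) x y)) (abs-* (+ suc n) (x - y))
    ... | inj₁ p∣n = contradiction p∣n (>⇒∤ n<p)
    ... | inj₂ p∣x-y = congruent (∣ᵤ⇒∣ p∣x-y)

    -- Both sides satisfy (n + 1) t (n + 1) = 2 (2 n + 1) t n modulo p = 2 m + 1.
    centralBinomial≈term : ∀ n → n ℕ.< suc (2 ℕ.* m) → + ((2 ℕ.* n) C n) ≈ term m n
    centralBinomial≈term zero    _   = refl
    centralBinomial≈term (suc n) n<p = *-cancelˡ {n} n<p (begin
      + suc n * + ((2 ℕ.* suc n) C suc n)                      ≡⟨ pos-* (suc n) _ ⟨
      + (suc n ℕ.* ((2 ℕ.* suc n) C suc n))                    ≡⟨ ≡.cong +_ ([n+1]*centralBinomial n) ⟩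
      + ((2 ℕ.* suc (2 ℕ.* n)) ℕ.* ((2 ℕ.* n) C n))            ≡⟨ pos-* (2 ℕ.* suc (2 ℕ.* n)) _ ⟩
      + (2 ℕ.* suc (2 ℕ.* n)) * + ((2 ℕ.* n) C n)              ≈⟨ *-cong (refl {+ (2 ℕ.* suc (2 ℕ.* n))}) (centralBinomial≈term n (ℕ.<-trans (ℕ.n<1+n n) n<p)) ⟩
      + (2 ℕ.* suc (2 ℕ.* n)) * (e * x)                        ≡⟨ ≡.cong (_* (e * x)) pos-factor ⟩
      -- 2(1 + 2n) = -4(m - n) + 2(1 + 2m), and the last summand is a multiple of p. This is where
      -- the base -4 arises.
      + 2 * (+ 1 + + 2 * + n) * (e * x)                        ≡⟨ separate (+ n) (+ m) e x ⟩
      - + 4 * e * (+ m * x - + n * x) + (+ 1 + + 2 * + m) * (+ 2 * e * x)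
                                                               ≡⟨ ≡.cong₂ (λ u v → - + 4 * e * u + v * (+ 2 * e * x)) (m*mCk-k*mCk m n) pos-p ⟩
      - + 4 * e * (+ suc n * + (m C suc n)) + + suc (2 ℕ.* m) * (+ 2 * e * x)
                                                               ≈⟨ +-cong (refl { - + 4 * e * (+ suc n * + (m C suc n))}) (multiple≈0 (+ 2 * e * x)) ⟩
      - + 4 * e * (+ suc n * + (m C suc n)) + + 0              ≡⟨ rearrange e (+ suc n) (+ (m C suc n)) ⟩
      + suc n * term m (suc n)                                 ∎)
      where
      open import Relation.Binary.Reasoning.Setoid setoid
      e = [-4]^ n
      x = + (m C n)
      pos-factor : + (2 ℕ.* suc (2 ℕ.* n)) ≡ + 2 * (+ 1 + + 2 * + n)
      pos-factor = ≡.trans (pos-* 2 (suc (2 ℕ.* n))) (≡.cong (λ z → + 2 * (+ 1 + z)) (pos-* 2 n))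
      pos-p : + 1 + + 2 * + m ≡ + suc (2 ℕ.* m)
      pos-p = ≡.cong (λ z → + 1 + z) (≡.sym (pos-* 2 m))
      separate : ∀ n m e x → + 2 * (+ 1 + + 2 * n) * (e * x)
        ≡ - + 4 * e * (m * x - n * x) + (+ 1 + + 2 * m) * (+ 2 * e * x)
      separate = solve-∀
      rearrange : ∀ e k z → - + 4 * e * (k * z) + + 0 ≡ k * (- + 4 * e * z)
      rearrange = solve-∀

  -- With `imagSum`, the expansion of (1 + 4i)ᵐ through index 2K + 1, split by parity. Since `term`
  -- uses powers of -4 in place of 4, the odd part carries an extra minus sign.
  realSum : ℕ → ℕ → ℤ
  realSum m zero    = term m 0
  realSum m (suc K) = realSum m K + sign (suc K) * term m (suc K ℕ.* 2)

  imagSum : ℕ → ℕ → ℤ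
  imagSum m zero    = - term m 1
  imagSum m (suc K) = imagSum m K - sign (suc K) * term m (suc (suc K ℕ.* 2))

  term-suc : ∀ m k → term (suc m) (suc k) ≡ - + 4 * term m k + term m (suc k)
  term-suc m k = ≡.trans
    (≡.cong (λ z → [-4]^ (suc k) * z) (≡.trans (≡.cong +_ (≡.sym (nCk+nC[k+1]≡[n+1]C[k+1] m k))) (pos-+ (m C k) _)))
    (distribute ([-4]^ k) (+ (m C k)) (+ (m C suc k)))
    where
    distribute : ∀ e x y → - + 4 * e * (x + y) ≡ - + 4 * (e * x) + - + 4 * e * y
    distribute = solve-∀

  imagSum-suc : ∀ m K → imagSum (suc m) K ≡ + 1 * imagSum m K + + 4 * realSum m K
  imagSum-suc m zero    = ≡.trans (≡.cong -_ (term-suc m 0)) (simplify (term m 0) (term m 1))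
    where
    simplify : ∀ x y → - (- + 4 * x + y) ≡ + 1 * - y + + 4 * x
    simplify = solve-∀
  imagSum-suc m (suc K) = ≡.trans
    (≡.cong₂ (λ u v → u - sign (suc K) * v) (imagSum-suc m K) (term-suc m (suc K ℕ.* 2)))
    (simplify (imagSum m K) (realSum m K) (sign (suc K)) (term m (suc K ℕ.* 2)) (term m (suc (suc K ℕ.* 2))))
    where
    simplify : ∀ i r s x y → (+ 1 * i + + 4 * r) - s * (- + 4 * x + y) ≡ + 1 * (i - s * y) + + 4 * (r + s * x)
    simplify = solve-∀

  -- Multiplication by 1 + 4i turns the top odd index 2K + 1 into 2K + 2, beyond the truncation; the
  -- last summand takes this contribution back.
  realSum-suc : ∀ m K → realSum (suc m) K ≡ (+ 1 * realSum m K - + 4 * imagSum m K) - + 4 * (sign K * term m (suc (K ℕ.* 2)))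
  realSum-suc m zero    = simplify (term m 0) (term m 1)
    where
    simplify : ∀ x y → x ≡ (+ 1 * x - + 4 * - y) - + 4 * (+ 1 * y)
    simplify = solve-∀
  realSum-suc m (suc K) = ≡.trans
    (≡.cong₂ (λ u v → u + - sign K * v) (realSum-suc m K) (term-suc m (suc (K ℕ.* 2))))
    (simplify (realSum m K) (imagSum m K) (sign K) (term m (suc (K ℕ.* 2))) (term m (suc K ℕ.* 2)) (term m (suc (suc K ℕ.* 2))))
    where
    simplify : ∀ r i s x y z → ((+ 1 * r - + 4 * i) - + 4 * (s * x)) + - s * (- + 4 * x + y)
      ≡ (+ 1 * (r + - s * y) - + 4 * (i - - s * z)) - + 4 * (- s * z)
    simplify = solve-∀

  module _ {n : ℕ} where

    open GaussianIntegers.Modulo n using (commutativeSemiring)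
    open import Algebra.Properties.Semiring.Exp (CommutativeSemiring.semiring commutativeSemiring) using (_^_)

    -- Induction on `m` with the truncation `K` fixed: the bound makes the binomial coefficient in
    -- the boundary term of `realSum-suc` vanish. The equality is exact in ℤ[i].
    [1+4i]^m : ∀ {m} K → m ℕ.≤ suc (K ℕ.* 2) → ⟨ + 1 , + 4 ⟩ ^ m ≡ ⟨ realSum m K , imagSum m K ⟩
    [1+4i]^m {zero}  K _ = ≡.sym (≡.cong₂ ⟨_,_⟩ (realSum-zero K) (imagSum-zero K))
      where
      realSum-zero : ∀ K → realSum 0 K ≡ + 1
      realSum-zero zero    = ≡.refl
      realSum-zero (suc K) rewrite realSum-zero K | *-zeroʳ ([-4]^ (suc K ℕ.* 2)) | *-zeroʳ (sign (suc K)) = ≡.refl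
      imagSum-zero : ∀ K → imagSum 0 K ≡ + 0
      imagSum-zero zero    = ≡.refl
      imagSum-zero (suc K) rewrite imagSum-zero K | *-zeroʳ ([-4]^ (suc (suc K ℕ.* 2))) | *-zeroʳ (sign (suc K)) = ≡.refl
    [1+4i]^m {suc m} K m≤2K rewrite [1+4i]^m {m} K (ℕ.<⇒≤ m≤2K) = ≡.cong₂ ⟨_,_⟩
      (≡.sym (≡.trans (realSum-suc m K) (≡.trans
        (≡.cong (λ z → x - + 4 * (sign K * (e * + z))) (k>n⇒nCk≡0 {m} m≤2K))
        (vanish x (sign K) e))))
      (≡.sym (imagSum-suc m K))
      where
      x = + 1 * realSum m K - + 4 * imagSum m K
      e = [-4]^ (suc (K ℕ.* 2))
      vanish : ∀ x s e → x - + 4 * (s * (e * + 0)) ≡ x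
      vanish = solve-∀

  module _ {m} (p-prime : Prime (suc (2 ℕ.* m))) where

    open Congruence (suc (2 ℕ.* m))

    sumTo≈realSum : ∀ K → K ℕ.* 2 ℕ.≤ 2 ℕ.* m → sumTo K ≈ realSum m K
    sumTo≈realSum zero    _      = refl
    sumTo≈realSum (suc K) 2K≤2m = +-cong
      (sumTo≈realSum K (ℕ.≤-trans (ℕ.m≤n+m (K ℕ.* 2) 2) 2K≤2m))
      (*-cong (refl {sign (suc K)}) (trans
        (reflexive (≡.cong₂ (λ i j → + (i C j)) 4k≡2[k2] (ℕ.*-comm 2 (suc K))))
        (centralBinomial≈term {m} p-prime (suc K ℕ.* 2) (ℕ.s≤s 2K≤2m))))
      where
      4k≡2[k2] : 4 ℕ.* suc K ≡ 2 ℕ.* (suc K ℕ.* 2)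
      4k≡2[k2] = ≡.trans (ℕ.*-assoc 2 2 (suc K)) (≡.cong (2 ℕ.*_) (ℕ.*-comm 2 (suc K)))

-- Powers of elements known through their action

module PowerLemmas {c ℓ} (R : CommutativeSemiring c ℓ) where

  open CommutativeSemiring R
  open import Algebra.Properties.Semiring.Exp semiring using (_^_; ^-homo-*; ^-assocʳ; ^-congˡ)
  open import Algebra.Properties.CommutativeSemiring.Exp R using (^-distrib-*)
  open import Algebra.Solver.CommutativeMonoid *-commutativeMonoid using (solve; _⊕_; _⊜_)
  open import Relation.Binary.Reasoning.Setoid setoid

  -- The relation is assumed on `t` alone, because γ² agrees with 17 only after multiplication by
  -- suitable elements.
  eigen-^ : ∀ {s k t} n → s * t ≈ k * t → s ^ n * t ≈ k ^ n * t
  eigen-^ zero    _ = refl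
  eigen-^ {s} {k} {t} (suc n) st≈kt = begin
    s * s ^ n * t     ≈⟨ *-assoc _ _ _ ⟩
    s * (s ^ n * t)   ≈⟨ *-congˡ (eigen-^ n st≈kt) ⟩
    s * (k ^ n * t)   ≈⟨ solve 3 (λ s k t → s ⊕ (k ⊕ t) ⊜ k ⊕ (s ⊕ t)) refl s (k ^ n) t ⟩
    k ^ n * (s * t)   ≈⟨ *-congˡ st≈kt ⟩
    k ^ n * (k * t)   ≈⟨ solve 3 (λ q k t → q ⊕ (k ⊕ t) ⊜ (k ⊕ q) ⊕ t) refl (k ^ n) k t ⟩
    k * k ^ n * t     ∎

  1^n≈1 : ∀ n → 1# ^ n ≈ 1#
  1^n≈1 zero    = refl
  1^n≈1 (suc n) = trans (*-identityˡ _) (1^n≈1 n)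

  -- The hypothesis retains the factor `x ^ e` so as to cover x = 0, the value of χ at 0, for which
  -- `x ^ d` is not 1.
  periodic-^ : ∀ {x} e d → x ^ d * x ^ e ≈ x ^ e → ∀ q → x ^ (e ℕ.+ q ℕ.* d) ≈ x ^ e
  periodic-^ {x} e d x^d*x^e≈x^e q = begin
    x ^ (e ℕ.+ q ℕ.* d)   ≡⟨ ≡.cong (λ k → x ^ (e ℕ.+ k)) (ℕ.*-comm q d) ⟩
    x ^ (e ℕ.+ d ℕ.* q)   ≈⟨ ^-homo-* x e (d ℕ.* q) ⟩
    x ^ e * x ^ (d ℕ.* q) ≈⟨ *-congˡ (^-assocʳ x d q) ⟨
    x ^ e * (x ^ d) ^ q   ≈⟨ *-comm _ _ ⟩
    (x ^ d) ^ q * x ^ e   ≈⟨ eigen-^ q (trans x^d*x^e≈x^e (sym (*-identityˡ _))) ⟩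
    1# ^ q * x ^ e        ≈⟨ *-congʳ (1^n≈1 q) ⟩
    1# * x ^ e            ≈⟨ *-identityˡ _ ⟩
    x ^ e                 ∎

  ^-2* : ∀ x k → x ^ (2 ℕ.* k) ≈ (x * x) ^ k
  ^-2* x k = trans (sym (^-assocʳ x 2 k)) (^-congˡ k (*-congˡ (*-identityʳ x)))

  eigen-^-2* : ∀ g k t n → g * g * t ≈ k * t → g ^ (2 ℕ.* n) * t ≈ k ^ n * t
  eigen-^-2* g k t n ggt≈kt = trans (*-congʳ (^-2* g n)) (eigen-^ n ggt≈kt)

  eigen-^-1+2* : ∀ g k n → g * g * g ≈ k * g → g ^ suc (2 ℕ.* n) ≈ k ^ n * g
  eigen-^-1+2* g k n ggg≈kg = trans (*-comm g _) (eigen-^-2* g k g n ggg≈kg)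

  square-^-1+2* : ∀ a g t m → t * t ≈ a * g → t ^ suc (2 ℕ.* m) ≈ a ^ m * (g ^ m * t)
  square-^-1+2* a g t m tt≈ag = begin
    t * t ^ (2 ℕ.* m)     ≈⟨ *-congˡ (^-2* t m) ⟩
    t * (t * t) ^ m       ≈⟨ *-congˡ (^-congˡ m tt≈ag) ⟩
    t * (a * g) ^ m       ≈⟨ *-congˡ (^-distrib-* a g m) ⟩
    t * (a ^ m * g ^ m)   ≈⟨ *-comm t _ ⟩
    a ^ m * g ^ m * t     ≈⟨ *-assoc _ _ _ ⟩
    a ^ m * (g ^ m * t)   ∎

  ^-1+2*-* : ∀ g t r → g ^ suc (2 ℕ.* r) * t ≈ g ^ (2 ℕ.* r) * (g * t)
  ^-1+2*-* g t r = trans (*-congʳ (*-comm g _)) (*-assoc _ g t)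

  -- Removes `n * b` from `a * (n * b)` without presupposing inverses: `N * j * v` is 1 and `N`
  -- contains `n * b`, so the remaining factors of `N * j * v` form an inverse.
  isolate : ∀ {a b b′ n N j u v} → a * (n * b) ≈ u → N ≈ b * b′ * (n * n) → N * j ≈ v → v * v ≈ 1# →
    a ≈ u * (b′ * (j * v)) * n
  isolate {a} {b} {b′} {n} {N} {j} {u} {v} anb≈u N≈ Nj≈v vv≈1 = begin
    a                                    ≈⟨ *-identityʳ a ⟨
    a * 1#                               ≈⟨ *-congˡ vv≈1 ⟨
    a * (v * v)                          ≈⟨ *-congˡ (*-congʳ Nj≈v) ⟨
    a * (N * j * v)                      ≈⟨ *-congˡ (*-congʳ (*-congʳ N≈)) ⟩
    a * (b * b′ * (n * n) * j * v)       ≈⟨ solve 6 (λ a b b′ n j v →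
                                             a ⊕ ((((b ⊕ b′) ⊕ (n ⊕ n)) ⊕ j) ⊕ v) ⊜
                                             ((a ⊕ (n ⊕ b)) ⊕ (b′ ⊕ (j ⊕ v))) ⊕ n) refl a b b′ n j v ⟩
    a * (n * b) * (b′ * (j * v)) * n     ≈⟨ *-congʳ (*-congʳ anb≈u) ⟩
    u * (b′ * (j * v)) * n               ∎

-- Arithmetic of ℤ/17

module Modulo17 where

  open import Data.Nat using (_+_; _*_; _∸_; _%_; _/_)
  open import Data.Fin using (toℕ)
  open import Data.Fin.Patterns using (0F)
  open import Data.Fin.Properties using (_≟_; all?)
  open import Data.Nat.DivMod using (_mod_; m≡m%n+[m/n]*n)
  open import Relation.Nullary.Decidable using (toWitness)

  infixl 6 _⊖_
  _⊖_ : Fin 17 → Fin 17 → Fin 17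
  a ⊖ b = (toℕ a + (17 ∸ toℕ b)) mod 17

  isSubtraction : IsSubtraction _⊖_ 0F
  isSubtraction = record
    { ⊖-identityʳ  = toWitness {a? = all? λ a → a ⊖ 0F ≟ a} _
    ; ⊖-involutive = toWitness {a? = all? λ a → all? λ b → a ⊖ (a ⊖ b) ≟ b} _
    ; ⊖-exchange   = toWitness {a? = all? λ a → all? λ b → all? λ c → (a ⊖ b) ⊖ c ≟ (a ⊖ c) ⊖ b} _
    }

  open IsSubtraction isSubtraction using (_⊕_; _⊙_)

  17-fold-⊕ : ∀ a b → fold b (a ⊕_) 17 ≡ b
  17-fold-⊕ = toWitness {a? = all? λ a → all? λ b → fold b (a ⊕_) 17 ≟ b} _

  ⊙-% : ∀ k a → k ⊙ a ≡ (k % 17) ⊙ a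
  ⊙-% k a = ≡.trans (≡.cong (_⊙ a) (≡.trans (m≡m%n+[m/n]*n k 17) (ℕ.+-comm (k % 17) _))) (reduce (k / 17))
    where
    reduce : ∀ q → (q * 17 + k % 17) ⊙ a ≡ (k % 17) ⊙ a
    reduce zero    = ≡.refl
    reduce (suc q) = ≡.trans (17-fold-⊕ a ((q * 17 + k % 17) ⊙ a)) (reduce q)

-- Quartic and quadratic Gauss sums modulo 17

module GaussSums {p} (p-prime : Prime p) where

  open import Data.Fin.Patterns using (1F)
  open import Data.Fin.Properties using (all?)
  open import Data.Nat.DivMod using (_%_)
  open import Data.Vec using ([]; _∷_; lookup)
  open import Relation.Nullary.Decidable using (toWitness)
  open Modulo17 using (isSubtraction; ⊙-%)
  open IsSubtraction isSubtraction using (_⊙_)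
  open BinomialSums using (realSum; [1+4i]^m)
  open GaussianIntegers using (ℤ[i]; ⟨_,_⟩; re; im; _≟_)
  open GaussianIntegers.Modulo p using (n×x≈0; re-cong) renaming (commutativeSemiring to ℤ[i]/p)
  open CommutativeSemiring ℤ[i]/p hiding (zero)
  open import Algebra.Properties.Semiring.Exp semiring using (_^_; ^-homo-*)
  open import Algebra.Properties.Semiring.Sum semiring using (sum; sum-cong-≋)
  open GroupSemiring ℤ[i]/p isSubtraction renaming (commutativeSemiring to ℤ[i]/p[C₁₇])
  private
    module R = PowerLemmas ℤ[i]/p
    module G where
      open CommutativeSemiring ℤ[i]/p[C₁₇] public
      open PowerLemmas ℤ[i]/p[C₁₇] public
      open import Algebra.Properties.Semiring.Exp (CommutativeSemiring.semiring ℤ[i]/p[C₁₇]) public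

  1+4i 1-4i -1ᵍ 17ᵍ : ℤ[i]
  1+4i = ⟨ + 1 , + 4 ⟩
  1-4i = ⟨ + 1 , -[1+ 3 ] ⟩
  -1ᵍ  = ⟨ -[1+ 0 ] , + 0 ⟩
  17ᵍ  = ⟨ + 17 , + 0 ⟩

  -- The quartic character modulo 17 with χ 3 = − i.
  χ : Fin 17 → ℤ[i]
  χ = lookup (𝟘 ∷ 𝟙 ∷ -𝟙 ∷ -𝕚 ∷ 𝟙 ∷ -𝕚 ∷ 𝕚 ∷ 𝕚 ∷ -𝟙 ∷ -𝟙 ∷ 𝕚 ∷ 𝕚 ∷ -𝕚 ∷ 𝟙 ∷ -𝕚 ∷ -𝟙 ∷ 𝟙 ∷ [])
    where
    𝟘 𝟙 -𝟙 𝕚 -𝕚 : ℤ[i]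
    𝟘  = ⟨ + 0 , + 0 ⟩
    𝟙  = ⟨ + 1 , + 0 ⟩
    -𝟙 = ⟨ -[1+ 0 ] , + 0 ⟩
    𝕚  = ⟨ + 0 , + 1 ⟩
    -𝕚 = ⟨ + 0 , -[1+ 0 ] ⟩

  -- The Gauss sum of χ and minus that of χ². The sign of γ and the choice of χ among the two
  -- quartic characters make the factor in `τ*τ` exactly 1 + 4i, as the Jacobi sum of χ with itself
  -- is -1 - 4i.
  τ γ : Element
  τ   = χ
  γ a = -1ᵍ * χ a ^ 2

  by-evaluation : ∀ {f g : Element} → (∀ a → f a ≡ g a) → f ≋ g
  by-evaluation f≡g .at a = reflexive (f≡g a)

  τ*τ : τ *ᴳ τ ≋ constant 1+4i *ᴳ γ
  τ*τ = by-evaluation (toWitness {a? = all? λ a → (τ *ᴳ τ) a ≟ (constant 1+4i *ᴳ γ) a} _)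

  -- γ² has coefficient 16 at 0 and -1 elsewhere; it is 17 minus the sum of all xᵃ, and that sum
  -- annihilates τ.
  γ*γ*τ : (γ *ᴳ γ) *ᴳ τ ≋ constant 17ᵍ *ᴳ τ
  γ*γ*τ = by-evaluation (toWitness {a? = all? λ a → ((γ *ᴳ γ) *ᴳ τ) a ≟ (constant 17ᵍ *ᴳ τ) a} _)

  γ*γ*γ : (γ *ᴳ γ) *ᴳ γ ≋ constant 17ᵍ *ᴳ γ
  γ*γ*γ = by-evaluation (toWitness {a? = all? λ a → ((γ *ᴳ γ) *ᴳ γ) a ≟ (constant 17ᵍ *ᴳ γ) a} _)

  γ*γ*[γ*τ] : (γ *ᴳ γ) *ᴳ (γ *ᴳ τ) ≋ constant 17ᵍ *ᴳ (γ *ᴳ τ)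
  γ*γ*[γ*τ] = by-evaluation (toWitness {a? = all? λ a → ((γ *ᴳ γ) *ᴳ (γ *ᴳ τ)) a ≟ (constant 17ᵍ *ᴳ (γ *ᴳ τ)) a} _)

  τ^-at-1 : ∀ m → (τ G.^ suc (2 ℕ.* m)) 1F ≈ 1+4i ^ m * ((γ G.^ m) *ᴳ τ) 1F
  τ^-at-1 m = trans (G.square-^-1+2* (constant 1+4i) γ τ m τ*τ .at 1F)
    (constant^-*-at 1+4i m ((γ G.^ m) *ᴳ τ) 1F)

  γ^-*τ-at-1 : ∀ r → ((γ G.^ (2 ℕ.* r)) *ᴳ τ) 1F ≈ 17ᵍ ^ r * 1#
  γ^-*τ-at-1 r = trans (G.eigen-^-2* γ (constant 17ᵍ) τ r γ*γ*τ .at 1F) (constant^-*-at 17ᵍ r τ 1F)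

  -- An odd power leaves one factor γ over; the coefficient of γτ at x¹ is again a Jacobi sum up to
  -- sign, and equals 1 + 4i.
  γ^1+-*τ-at-1 : ∀ r → ((γ G.^ suc (2 ℕ.* r)) *ᴳ τ) 1F ≈ 17ᵍ ^ r * 1+4i
  γ^1+-*τ-at-1 r = trans
    (G.trans (G.^-1+2*-* γ τ r) (G.eigen-^-2* γ (constant 17ᵍ) (γ *ᴳ τ) r γ*γ*[γ*τ]) .at 1F)
    (constant^-*-at 17ᵍ r (γ *ᴳ τ) 1F)

  -- Compared with the Frobenius image of γ, this says that 17ᵐ is the quadratic character of p
  -- modulo 17: Euler's criterion joined to quadratic reciprocity.
  γ^-at-1 : ∀ m → (γ G.^ suc (2 ℕ.* m)) 1F ≈ 17ᵍ ^ m * -1ᵍ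
  γ^-at-1 m = trans (G.eigen-^-1+2* γ (constant 17ᵍ) m γ*γ*γ .at 1F) (constant^-*-at 17ᵍ m γ 1F)

  frobenius-at-1 : Element → ℕ → ℕ → ℤ[i]
  frobenius-at-1 f e s = sum (λ a → monomial (f a ^ e) (s ⊙ a) 1F)

  -- Exponents reduce modulo 4 and multiples in the group modulo 17, so the unknown p disappears in
  -- favour of `e` and `p % 17`.
  ^p-at-1 : ∀ f e q → p ≡ e ℕ.+ q ℕ.* 4 → (∀ a → f a ^ 4 * f a ^ e ≡ f a ^ e) →
    (f G.^ p) 1F ≈ frobenius-at-1 f e (p % 17)
  ^p-at-1 f e q p≡e+4q f⁴f^e≡f^e = trans (^p-at p-prime n×x≈0 f 1F) (sum-cong-≋ reduce)
    where
    reduce : ∀ a → monomial (f a ^ p) (p ⊙ a) 1F ≈ monomial (f a ^ e) ((p % 17) ⊙ a) 1F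
    reduce a = trans
      (monomial-cong (p ⊙ a) (trans (reflexive (≡.cong (f a ^_) p≡e+4q))
        (R.periodic-^ {f a} e 4 (reflexive (f⁴f^e≡f^e a)) q)) .at 1F)
      (reflexive (≡.cong (λ b → monomial (f a ^ e) b 1F) (⊙-% p a)))

  χ⁴χ≡χ : ∀ a → τ a ^ 4 * τ a ^ 1 ≡ τ a ^ 1
  χ⁴χ≡χ = toWitness {a? = all? λ a → (τ a ^ 4 * τ a ^ 1) ≟ (τ a ^ 1)} _

  χ⁴χ³≡χ³ : ∀ a → τ a ^ 4 * τ a ^ 3 ≡ τ a ^ 3
  χ⁴χ³≡χ³ = toWitness {a? = all? λ a → (τ a ^ 4 * τ a ^ 3) ≟ (τ a ^ 3)} _

  γ⁴γ≡γ : ∀ a → γ a ^ 4 * γ a ^ 1 ≡ γ a ^ 1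
  γ⁴γ≡γ = toWitness {a? = all? λ a → (γ a ^ 4 * γ a ^ 1) ≟ (γ a ^ 1)} _

  γ⁴γ³≡γ³ : ∀ a → γ a ^ 4 * γ a ^ 3 ≡ γ a ^ 3
  γ⁴γ³≡γ³ = toWitness {a? = all? λ a → (γ a ^ 4 * γ a ^ 3) ≟ (γ a ^ 3)} _

  17^k : ∀ k → 17ᵍ ^ k ≡ ⟨ + (17 ℕ.^ k) , + 0 ⟩
  17^k zero    = ≡.refl
  17^k (suc k) rewrite 17^k k = ≡.cong₂ ⟨_,_⟩
    (≡.trans (ℤ.+-identityʳ _) (≡.sym (ℤ.pos-* 17 (17 ℕ.^ k)))) ≡.refl

  17^[2*r] : ∀ r → 17ᵍ ^ (2 ℕ.* r) ≈ 17ᵍ ^ r * 17ᵍ ^ r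
  17^[2*r] r = trans (^-homo-* 17ᵍ r (r ℕ.+ 0)) (*-congˡ {17ᵍ ^ r} (reflexive (≡.cong (17ᵍ ^_) (ℕ.+-identityʳ r))))

  -- The quotient (1 + 4i)ᵐ / 17ʳ for p ≡ s mod 17 and p = 4r + e, where b′ is 1
  -- if e = 1 and 1 − 4i if e = 3.
  weight : ℕ → ℤ[i] → ℕ → ℤ[i]
  weight e b′ s = frobenius-at-1 τ e s * (b′ * (-1ᵍ * frobenius-at-1 γ e s))

  -- The coefficient is minus the quadratic character of `s`, so its square is 1 when 17 does not
  -- divide `s`. This supplies the inverse used in `isolate`.
  γ-unit : ℕ → ℕ → Set
  γ-unit e s = frobenius-at-1 γ e s * frobenius-at-1 γ e s ≡ 1#

  [1+4i]^[2*r] : ∀ r → p ≡ suc (2 ℕ.* (2 ℕ.* r)) → γ-unit 1 (p % 17) →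
    1+4i ^ (2 ℕ.* r) ≈ weight 1 1# (p % 17) * 17ᵍ ^ r
  [1+4i]^[2*r] r p≡1+4r v*v≡1 = R.isolate
    {1+4i ^ m} {1#} {1#} {17ᵍ ^ r} {17ᵍ ^ m} { -1ᵍ} {frobenius-at-1 τ 1 (p % 17)} {frobenius-at-1 γ 1 (p % 17)}
    (begin
      1+4i ^ m * (17ᵍ ^ r * 1#)           ≈⟨ *-congˡ {1+4i ^ m} (γ^-*τ-at-1 r) ⟨
      1+4i ^ m * ((γ G.^ m) *ᴳ τ) 1F      ≈⟨ τ^-at-1 m ⟨
      (τ G.^ suc (2 ℕ.* m)) 1F            ≡⟨ ≡.cong (λ k → (τ G.^ k) 1F) p≡1+4r ⟨
      (τ G.^ p) 1F                        ≈⟨ ^p-at-1 τ 1 r p≡1+r*4 χ⁴χ≡χ ⟩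
      frobenius-at-1 τ 1 (p % 17)         ∎)
    (trans (17^[2*r] r) (sym (*-identityˡ (17ᵍ ^ r * 17ᵍ ^ r))))
    (begin
      17ᵍ ^ m * -1ᵍ                       ≈⟨ γ^-at-1 m ⟨
      (γ G.^ suc (2 ℕ.* m)) 1F            ≡⟨ ≡.cong (λ k → (γ G.^ k) 1F) p≡1+4r ⟨
      (γ G.^ p) 1F                        ≈⟨ ^p-at-1 γ 1 r p≡1+r*4 γ⁴γ≡γ ⟩
      frobenius-at-1 γ 1 (p % 17)         ∎)
    (reflexive v*v≡1)
    where
    open import Relation.Binary.Reasoning.Setoid setoid
    m = 2 ℕ.* r
    regroup : ∀ r → suc (2 ℕ.* (2 ℕ.* r)) ≡ 1 ℕ.+ r ℕ.* 4
    regroup = ℕ.solve-∀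
    p≡1+r*4 : p ≡ 1 ℕ.+ r ℕ.* 4
    p≡1+r*4 = ≡.trans p≡1+4r (regroup r)

  [1+4i]^[1+2*r] : ∀ r → p ≡ suc (2 ℕ.* suc (2 ℕ.* r)) → γ-unit 3 (p % 17) →
    1+4i ^ suc (2 ℕ.* r) ≈ weight 3 1-4i (p % 17) * 17ᵍ ^ r
  [1+4i]^[1+2*r] r p≡3+4r v*v≡1 = R.isolate
    {1+4i ^ m} {1+4i} {1-4i} {17ᵍ ^ r} {17ᵍ ^ m} { -1ᵍ} {frobenius-at-1 τ 3 (p % 17)} {frobenius-at-1 γ 3 (p % 17)}
    (begin
      1+4i ^ m * (17ᵍ ^ r * 1+4i)         ≈⟨ *-congˡ {1+4i ^ m} (γ^1+-*τ-at-1 r) ⟨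
      1+4i ^ m * ((γ G.^ m) *ᴳ τ) 1F      ≈⟨ τ^-at-1 m ⟨
      (τ G.^ suc (2 ℕ.* m)) 1F            ≡⟨ ≡.cong (λ k → (τ G.^ k) 1F) p≡3+4r ⟨
      (τ G.^ p) 1F                        ≈⟨ ^p-at-1 τ 3 r p≡3+r*4 χ⁴χ³≡χ³ ⟩
      frobenius-at-1 τ 3 (p % 17)         ∎)
    -- Here m = 2r + 1, and the extra factor 17 is the computed product of 1 + 4i and 1 - 4i.
    (*-congˡ {17ᵍ} (17^[2*r] r))
    (begin
      17ᵍ ^ m * -1ᵍ                       ≈⟨ γ^-at-1 m ⟨
      (γ G.^ suc (2 ℕ.* m)) 1F            ≡⟨ ≡.cong (λ k → (γ G.^ k) 1F) p≡3+4r ⟨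
      (γ G.^ p) 1F                        ≈⟨ ^p-at-1 γ 3 r p≡3+r*4 γ⁴γ³≡γ³ ⟩
      frobenius-at-1 γ 3 (p % 17)         ∎)
    (reflexive v*v≡1)
    where
    open import Relation.Binary.Reasoning.Setoid setoid
    m = suc (2 ℕ.* r)
    regroup : ∀ r → suc (2 ℕ.* suc (2 ℕ.* r)) ≡ 3 ℕ.+ r ℕ.* 4
    regroup = ℕ.solve-∀
    p≡3+r*4 : p ≡ 3 ℕ.+ r ℕ.* 4
    p≡3+r*4 = ≡.trans p≡3+4r (regroup r)

  open Congruence p using () renaming (_≈_ to _≈ℤ_; trans to ≈ℤ-trans; reflexive to ≈ℤ-reflexive)

  -- Since 17ʳ is real, only the real part of `w` matters. The bound admits both m = 2r and m = 2r +
  -- 1, so stopping at r = [p/4] loses no term.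
  realSum≈ : ∀ m r w → m ℕ.≤ suc (r ℕ.* 2) → 1+4i ^ m ≈ w * 17ᵍ ^ r → realSum m r ≈ℤ re w ℤ.* + (17 ℕ.^ r)
  realSum≈ m r w m≤1+r*2 [1+4i]^m≈ = ≈ℤ-trans
    (≈ℤ-reflexive (≡.sym (≡.cong re ([1+4i]^m {p} r m≤1+r*2))))
    (≈ℤ-trans (re-cong [1+4i]^m≈)
      (≈ℤ-reflexive (≡.trans (≡.cong (λ z → re (w * z)) (17^k r)) (drop (re w) (im w) (+ (17 ℕ.^ r))))))
    where
    drop : ∀ x y n → x ℤ.* n ℤ.- y ℤ.* + 0 ≡ x ℤ.* n
    drop = ℤ.solve-∀

module _ {p} (p-prime : Prime p) where

  open import Data.Nat.DivMod using (_%_)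
  open import Defs using (sumTo)
  open BinomialSums using (sumTo≈realSum)
  open GaussSums p-prime
  open GaussianIntegers using (1#; re)
  open Congruence p

  sumTo≈₁ : ∀ r → p ≡ suc (2 ℕ.* (2 ℕ.* r)) → γ-unit 1 (p % 17) →
    sumTo r ≈ re (weight 1 1# (p % 17)) ℤ.* + (17 ℕ.^ r)
  sumTo≈₁ r ≡.refl v*v≡1 = trans
    (sumTo≈realSum {2 ℕ.* r} p-prime r (ℕ.≤-trans (ℕ.≤-reflexive (ℕ.*-comm r 2)) (ℕ.m≤n*m (2 ℕ.* r) 2)))
    (realSum≈ (2 ℕ.* r) r (weight 1 1# (p % 17)) (ℕ.m≤n⇒m≤1+n (ℕ.≤-reflexive (ℕ.*-comm 2 r)))
      ([1+4i]^[2*r] r ≡.refl v*v≡1))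

  sumTo≈₃ : ∀ r → p ≡ suc (2 ℕ.* suc (2 ℕ.* r)) → γ-unit 3 (p % 17) →
    sumTo r ≈ re (weight 3 1-4i (p % 17)) ℤ.* + (17 ℕ.^ r)
  sumTo≈₃ r ≡.refl v*v≡1 = trans
    (sumTo≈realSum {suc (2 ℕ.* r)} p-prime r
      (ℕ.≤-trans (ℕ.m≤n⇒m≤1+n (ℕ.≤-reflexive (ℕ.*-comm r 2))) (ℕ.m≤n*m (suc (2 ℕ.* r)) 2)))
    (realSum≈ (suc (2 ℕ.* r)) r (weight 3 1-4i (p % 17)) (ℕ.s≤s (ℕ.≤-reflexive (ℕ.*-comm 2 r)))
      ([1+4i]^[1+2*r] r ≡.refl v*v≡1))

open import Defs
open import Data.Nat using (_%_; _/_; _∸_; _^_)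
open import Data.Integer using (-_) renaming (_*_ to _*ℤ_)
open import Data.Product using (_×_; _,_)
open import Data.Sum using (_⊎_; [_,_])
open import Relation.Binary.PropositionalEquality using (_≢_)

-- Reading off the residue classes

module _ {p : ℕ} (p-prime : Prime p) where

  open import Data.Integer.Divisibility.Signed using (∣⇒∣ᵤ)
  open import Data.Nat.DivMod using (m≡m%n+[m/n]*n; m*n/n≡m)
  open GaussianIntegers using (1#; re)
  open GaussSums p-prime using (γ-unit; weight; 1-4i)
  open Congruence p using (_≈_; n∣x-y)

  p≡p%4+[p/4]*4 : ∀ {e} → p % 4 ≡ e → p ≡ e ℕ.+ p / 4 ℕ.* 4
  p≡p%4+[p/4]*4 p%4≡e = ≡.trans (m≡m%n+[m/n]*n p 4) (≡.cong (ℕ._+ p / 4 ℕ.* 4) p%4≡e)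

  p/4≡[p∸e]/4 : ∀ {e} → p % 4 ≡ e → p / 4 ≡ (p ∸ e) / 4
  p/4≡[p∸e]/4 {e} p%4≡e = ≡.sym (≡.trans
    (≡.cong (_/ 4) (≡.trans (≡.cong (_∸ e) (p≡p%4+[p/4]*4 p%4≡e)) (ℕ.m+n∸m≡n e (p / 4 ℕ.* 4))))
    (m*n/n≡m (p / 4) 4))

  -- The residue `s` is a variable of its own: at a numeral, the unit condition and the real part
  -- are decided by computation, independently of p.
  S-mod₁ : p % 4 ≡ 1 → ∀ {y} s c → c *ℤ + (17 ^ ((p ∸ 1) / 4)) ≡ y →
    γ-unit 1 s → re (weight 1 1# s) ≡ c → p % 17 ≡ s → S p ≡ y [mod p ]
  S-mod₁ p%4≡1 s c ≡.refl v*v≡1 ≡.refl ≡.refl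
    = ∣⇒∣ᵤ (n∣x-y (≡.subst (λ r → S p ≈ re (weight 1 1# s) *ℤ + (17 ^ r)) (p/4≡[p∸e]/4 p%4≡1)
        (sumTo≈₁ p-prime (p / 4) (≡.trans (p≡p%4+[p/4]*4 p%4≡1) (regroup (p / 4))) v*v≡1)))
    where
    regroup : ∀ r → 1 ℕ.+ r ℕ.* 4 ≡ suc (2 ℕ.* (2 ℕ.* r))
    regroup = ℕ.solve-∀

  S-mod₃ : p % 4 ≡ 3 → ∀ {y} s c → c *ℤ + (17 ^ ((p ∸ 3) / 4)) ≡ y →
    γ-unit 3 s → re (weight 3 1-4i s) ≡ c → p % 17 ≡ s → S p ≡ y [mod p ]
  S-mod₃ p%4≡3 s c ≡.refl v*v≡1 ≡.refl ≡.refl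
    = ∣⇒∣ᵤ (n∣x-y (≡.subst (λ r → S p ≈ re (weight 3 1-4i s) *ℤ + (17 ^ r)) (p/4≡[p∸e]/4 p%4≡3)
        (sumTo≈₃ p-prime (p / 4) (≡.trans (p≡p%4+[p/4]*4 p%4≡3) (regroup (p / 4))) v*v≡1)))
    where
    regroup : ∀ r → 3 ℕ.+ r ℕ.* 4 ≡ suc (2 ℕ.* suc (2 ℕ.* r))
    regroup = ℕ.solve-∀

theorem2p6 : (p : ℕ) → Prime p → p % 2 ≡ 1 → p ≢ 17 →
    ((p % 4 ≡ 1 →
    ((p % 17 ≡ 3 ⊎ p % 17 ≡ 14 ⊎ p % 17 ≡ 5 ⊎ p % 17 ≡ 12 ⊎ p % 17 ≡ 6 ⊎ p % 17 ≡ 11 ⊎ p % 17 ≡ 7 ⊎ p % 17 ≡ 10)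
    → S p ≡ + 0 [mod p ])
    × ((p % 17 ≡ 1 ⊎ p % 17 ≡ 16 ⊎ p % 17 ≡ 4 ⊎ p % 17 ≡ 13)
    → S p ≡ + (17 ^ ((p ∸ 1) / 4)) [mod p ])
    × ((p % 17 ≡ 2 ⊎ p % 17 ≡ 15 ⊎ p % 17 ≡ 8 ⊎ p % 17 ≡ 9)
    → S p ≡ - (+ (17 ^ ((p ∸ 1) / 4))) [mod p ]))
    × (p % 4 ≡ 3 →
    ((p % 17 ≡ 1 ⊎ p % 17 ≡ 16 ⊎ p % 17 ≡ 4 ⊎ p % 17 ≡ 13)
    → S p ≡ + (17 ^ ((p ∸ 3) / 4)) [mod p ])
    × ((p % 17 ≡ 2 ⊎ p % 17 ≡ 15 ⊎ p % 17 ≡ 8 ⊎ p % 17 ≡ 9)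
    → S p ≡ - (+ (17 ^ ((p ∸ 3) / 4))) [mod p ])
    × ((p % 17 ≡ 3 ⊎ p % 17 ≡ 14 ⊎ p % 17 ≡ 5 ⊎ p % 17 ≡ 12)
    → S p ≡ + 4 *ℤ + (17 ^ ((p ∸ 3) / 4)) [mod p ])
    × ((p % 17 ≡ 6 ⊎ p % 17 ≡ 11 ⊎ p % 17 ≡ 7 ⊎ p % 17 ≡ 10)
    → S p ≡ - (+ 4 *ℤ + (17 ^ ((p ∸ 3) / 4))) [mod p ])))
theorem2p6 p p-prime _ _ =
  (λ p%4≡1 →
    let residue = S-mod₁ p-prime p%4≡1
        zero₁  = λ s → residue s (+ 0) ≡.refl
        plus₁  = λ s → residue s (+ 1) (ℤ.*-identityˡ _)
        minus₁ = λ s → residue s -[1+ 0 ] (ℤ.-1*i≡-i _) in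
    -- For p ≡ 1 mod 4 the weight is χ(s): these residues have χ(s) = i or -i, hence real part 0,
    -- and the two later groups have 1 and -1.
    [ zero₁ 3 ≡.refl ≡.refl , [ zero₁ 14 ≡.refl ≡.refl , [ zero₁ 5 ≡.refl ≡.refl , [ zero₁ 12 ≡.refl ≡.refl
    , [ zero₁ 6 ≡.refl ≡.refl , [ zero₁ 11 ≡.refl ≡.refl , [ zero₁ 7 ≡.refl ≡.refl , zero₁ 10 ≡.refl ≡.refl ] ] ] ] ] ] ]
  , [ plus₁ 1 ≡.refl ≡.refl , [ plus₁ 16 ≡.refl ≡.refl , [ plus₁ 4 ≡.refl ≡.refl , plus₁ 13 ≡.refl ≡.refl ] ] ]
  , [ minus₁ 2 ≡.refl ≡.refl , [ minus₁ 15 ≡.refl ≡.refl , [ minus₁ 8 ≡.refl ≡.refl , minus₁ 9 ≡.refl ≡.refl ] ] ])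
  , (λ p%4≡3 →
    let residue = S-mod₃ p-prime p%4≡3
        plus₃   = λ s → residue s (+ 1) (ℤ.*-identityˡ _)
        minus₃  = λ s → residue s -[1+ 0 ] (ℤ.-1*i≡-i _)
        plus4₃  = λ s → residue s (+ 4) ≡.refl
        minus4₃ = λ s → residue s -[1+ 3 ] (≡.sym (ℤ.neg-distribˡ-* (+ 4) (+ (17 ^ ((p ∸ 3) / 4))))) in
    -- The weight is now 1 - 4i times the conjugate of χ(s), whose real part is 1, -1, 4 or -4 as
    -- χ(s) is 1, -1, -i or i.
    [ plus₃ 1 ≡.refl ≡.refl , [ plus₃ 16 ≡.refl ≡.refl , [ plus₃ 4 ≡.refl ≡.refl , plus₃ 13 ≡.refl ≡.refl ] ] ]
  , [ minus₃ 2 ≡.refl ≡.refl , [ minus₃ 15 ≡.refl ≡.refl , [ minus₃ 8 ≡.refl ≡.refl , minus₃ 9 ≡.refl ≡.refl ] ] ]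
  , [ plus4₃ 3 ≡.refl ≡.refl , [ plus4₃ 14 ≡.refl ≡.refl , [ plus4₃ 5 ≡.refl ≡.refl , plus4₃ 12 ≡.refl ≡.refl ] ] ]
  , [ minus4₃ 6 ≡.refl ≡.refl , [ minus4₃ 11 ≡.refl ≡.refl , [ minus4₃ 7 ≡.refl ≡.refl , minus4₃ 10 ≡.refl ≡.refl ] ] ])
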